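{- For any cycle $C_n$ of order $n\geq 3$, $\gamma_{\times 2R}(C_n)=2\left\lceil\frac{2n}{3}\right\rceil$.
   Context: For a finite simple graph $G=(V,E)$ with minimum degree at least $1$, a Roman $2$-tuple dominating function on $G$ is a function $f\colon V\to\{0,1,2\}$ such that every vertex $v$ with $f(v)=0$ has at least $2$ neighbors $w$ with $f(w)=2$, and every vertex $v$ with $f(v)\neq 0$ has at least $1$ neighbor $w$ with $f(w)=2$. The weight of $f$ is $f(V)=\sum_{v\in V}f(v)$, and $\gamma_{\times 2R}(G)$ is the minimum weight of a Roman $2$-tuple dominating function on $G$. -}

module Defs where

open import Data.Fin using (Fin; toℕ)
open import Data.Fin.Patterns using (0F; 2F)
open import Data.Fin.Properties using (_≟_)
open import Data.Fin.Subset using (Subset; ∣_∣; _∩_)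
open import Data.Fin.Subset.Properties using (∣p∩q∣≤∣p∣)
open import Data.Integer using (+_) renaming (∣_∣ to abs)
open import Data.Nat using (ℕ; suc; _≤_; s≤s; NonZero)
import Data.Nat.Properties as ℕ
open import Algebra.Properties.CommutativeMonoid.Sum ℕ.+-0-commutativeMonoid using (sum-syntax)
open import Data.Product using (∃-syntax; _×_; _,_)
open import Data.Rational.Unnormalised using (ceiling; _/_)
open import Data.Sum using (_⊎_; inj₁; inj₂; swap; [_,_])
open import Data.Vec using (tabulate)
open import Level using (0ℓ)
open import Relation.Binary using (Rel; Symmetric; Irreflexive; Decidable)
open import Relation.Binary.PropositionalEquality using (_≡_; _≢_; refl; sym; trans; cong)
open import Relation.Nullary using (¬_; yes; no; does)
open import Relation.Nullary.Decidable using (_×-dec_; _⊎-dec_)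

record Graph (n : ℕ) : Set₁ where
  field
    Adj    : Rel (Fin n) 0ℓ
    adj?   : Decidable Adj
    symm   : Symmetric Adj
    irrefl : Irreflexive _≡_ Adj

  N : Fin n → Subset n
  N v = tabulate λ w → does (adj? v w)

  degree : Fin n → ℕ
  degree v = ∣ N v ∣

Labelling : ℕ → Set
Labelling n = Fin n → Fin 3

V₂ : ∀ {n} → Labelling n → Subset n
V₂ f = tabulate λ w → does (f w ≟ 2F)

weight : ∀ {n} → Labelling n → ℕ
weight {n} f = ∑[ v < n ] toℕ (f v)

record IsRoman2TupleDominating {n} (G : Graph n) (f : Labelling n) : Set where
  open Graph G
  field
    label≡0 : ∀ v → f v ≡ 0F → 2 ≤ ∣ N v ∩ V₂ f ∣
    label≢0 : ∀ v → f v ≢ 0F → 1 ≤ ∣ N v ∩ V₂ f ∣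

-- The standing assumption of minimum degree at least 1 need not be imposed
-- separately: it follows from the existence of a dominating function.
dominating⇒1≤degree : ∀ {n} {G : Graph n} {f} → IsRoman2TupleDominating G f →
                      ∀ v → 1 ≤ Graph.degree G v
dominating⇒1≤degree {G = G} {f} d v with f v ≟ 0F
... | yes p = ℕ.≤-trans (ℕ.<⇒≤ (label≡0 v p)) (∣p∩q∣≤∣p∣ (Graph.N G v) (V₂ f))
  where open IsRoman2TupleDominating d
... | no ¬p = ℕ.≤-trans (label≢0 v ¬p) (∣p∩q∣≤∣p∣ (Graph.N G v) (V₂ f))
  where open IsRoman2TupleDominating d

-- γ×2R[ G ]≡ k reads "γ×2R(G) = k": the minimum weight is attained and equals k.
-- At most one k satisfies it.
γ×2R[_]≡_ : ∀ {n} → Graph n → ℕ → Set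
γ×2R[ G ]≡ k =
  (∃[ f ] IsRoman2TupleDominating G f × weight f ≡ k) ×
  (∀ f → IsRoman2TupleDominating G f → k ≤ weight f)

-- In the cyclic order 0 , 1 , … , n-1 , 0 the vertex j comes right after i.
Next : ∀ {n} → Rel (Fin n) 0ℓ
Next {n} i j = toℕ j ≡ suc (toℕ i) ⊎ (suc (toℕ i) ≡ n × toℕ j ≡ 0)

next? : ∀ {n} → Decidable (Next {n})
next? {n} i j = (toℕ j ℕ.≟ suc (toℕ i)) ⊎-dec ((suc (toℕ i) ℕ.≟ n) ×-dec (toℕ j ℕ.≟ 0))

next-irrefl : ∀ {n} → 3 ≤ n → ∀ (i : Fin n) → ¬ Next i i
next-irrefl _   i (inj₁ i≡1+i)         = ℕ.1+n≢n (sym i≡1+i)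
next-irrefl 3≤n i (inj₂ (1+i≡n , i≡0)) =
  ℕ.<⇒≢ (ℕ.<-trans (s≤s (s≤s ℕ.≤-refl)) 3≤n) (trans (cong suc (sym i≡0)) 1+i≡n)

C : ∀ n → 3 ≤ n → Graph n
C n 3≤n = record
  { Adj    = λ i j → Next i j ⊎ Next j i
  ; adj?   = λ i j → next? i j ⊎-dec next? j i
  ; symm   = swap
  ; irrefl = λ { {i} refl → [ next-irrefl 3≤n i , next-irrefl 3≤n i ] }
  }

-- The ceiling of the rational m / d; it is nonnegative, so taking the absolute
-- value only moves it from ℤ to ℕ.
⌈_/_⌉ : (m d : ℕ) .{{_ : NonZero d}} → ℕ
⌈ m / d ⌉ = abs (ceiling (+ m / d))

{-# OPTIONS --safe #-}

-- Any three consecutive labels of a dominating function sum to at least 4. If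
-- the middle label is 0, both outer ones are 2; otherwise one outer label is 2,
-- and when the middle label is 1 the other outer label is nonzero, because all
-- neighbours of a vertex labelled 0 are labelled 2. Moreover some two
-- consecutive vertices are labelled 2, since a vertex labelled 2 has a neighbour
-- labelled 2. Write n = r + 3k with r ≤ 2 and cut the cycle just before these
-- two vertices: the first r labels sum to 2r and the k remaining triples to at
-- least 4k, and 2r + 4k = 2⌈2n/3⌉. The labelling 2,2,0,2,2,0,… attains this.
module Submission where

open import Defs
open import Data.Fin using (Fin; zero; suc; toℕ)
open import Data.Fin.Patterns using (0F; 1F; 2F)
open import Data.Fin.Properties using (_≟_; toℕ-injective; toℕ-fromℕ<; toℕ<n)
open import Data.Fin.Subset using (Subset; ∣_∣; _∩_; _∈_; inside; outside; Nonempty)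
open import Data.Fin.Subset.Properties
  using (x∈p∩q⁺; x∈p∩q⁻; x∈p∧x≢y⇒x∈p-y; x∈p⇒∣p-x∣<∣p∣)
open import Data.Integer using (-[1+_])
import Data.Integer as ℤ
import Data.Integer.Properties as ℤ
open import Data.Nat
  using (ℕ; zero; suc; pred; _≤_; _*_; _+_; _⊓_; _/_; _%_; z≤n; s≤s; NonZero; >-nonZero)
open import Data.Nat.Divisibility using (n∣m*n)
open import Data.Nat.DivMod
  using (_mod_; _divMod_; result; m%n<n; m≡m%n+[m/n]*n; [m+kn]%n≡m%n; [m+n]%n≡m%n;
         n%n≡0; m*n/n≡m; m<n⇒m%n≡m; +-distrib-/-∣ʳ)
open import Data.Nat.Properties
  using (+-assoc; +-comm; +-suc; +-identityʳ; +-cancelˡ-≡; +-mono-≤; +-monoʳ-≤;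
         ≤-refl; ≤-trans; ≤-reflexive; <⇒≢; m≤m+n; m≤n+m; *-distribˡ-+; *-assoc;
         m≤n⇒m<n∨m≡n; suc-injective; suc-pred; 1+n≢0; module ≤-Reasoning;
         +-0-commutativeMonoid)
open import Algebra.Properties.CommutativeMonoid.Sum +-0-commutativeMonoid using (sum-syntax; sum-cong-≗)
open import Data.Nat.Solver using (module +-*-Solver)
open import Data.Product using (∃-syntax; _×_; _,_; proj₂)
open import Data.Sum using (_⊎_; inj₁; inj₂)
import Data.Sum as Sum
open import Data.Vec using (_∷_; tabulate; here; there)
open import Data.Vec.Properties using (lookup∘tabulate; lookup⇒[]=; []=⇒lookup)
open import Function using (_∘_)
open import Relation.Binary.PropositionalEquality
open import Relation.Nullary using (¬_; yes; no; does; contradiction)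
open import Relation.Nullary.Decidable using (dec-true)
open import Relation.Unary using (Pred; Decidable)

-- Membership and cardinality of finite subsets.

module _ {n p} {P : Pred (Fin n) p} (P? : Decidable P) where

  ∈-tabulate⁺ : ∀ {x} → P x → x ∈ tabulate (does ∘ P?)
  ∈-tabulate⁺ {x} px =
    lookup⇒[]= x _ (trans (lookup∘tabulate (does ∘ P?) x) (dec-true (P? x) px))

  ∈-tabulate⁻ : ∀ {x} → x ∈ tabulate (does ∘ P?) → P x
  ∈-tabulate⁻ {x} x∈ with P? x | trans (sym (lookup∘tabulate (does ∘ P?) x)) ([]=⇒lookup x∈)
  ... | yes px | _ = px

1≤∣p∣⇒Nonempty : ∀ {n} (p : Subset n) → 1 ≤ ∣ p ∣ → Nonempty p
1≤∣p∣⇒Nonempty (inside  ∷ p) _ = zero , here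
1≤∣p∣⇒Nonempty (outside ∷ p) 1≤∣p∣ with x , x∈p ← 1≤∣p∣⇒Nonempty p 1≤∣p∣ = suc x , there x∈p

2≤∣p∣⇒∃≢ : ∀ {n} (p : Subset n) → 2 ≤ ∣ p ∣ → ∃[ x ] ∃[ y ] x ∈ p × y ∈ p × x ≢ y
2≤∣p∣⇒∃≢ (inside  ∷ p) (s≤s 1≤∣p∣) with y , y∈p ← 1≤∣p∣⇒Nonempty p 1≤∣p∣ =
  zero , suc y , here , there y∈p , λ ()
2≤∣p∣⇒∃≢ (outside ∷ p) 2≤∣p∣ with x , y , x∈p , y∈p , x≢y ← 2≤∣p∣⇒∃≢ p 2≤∣p∣ =
  suc x , suc y , there x∈p , there y∈p , λ { refl → x≢y refl }

x∈p⇒1≤∣p∣ : ∀ {n} {p : Subset n} {x} → x ∈ p → 1 ≤ ∣ p ∣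
x∈p⇒1≤∣p∣ x∈p = ≤-trans (s≤s z≤n) (x∈p⇒∣p-x∣<∣p∣ x∈p)

-- Removing `y` strictly lowers the cardinality and still leaves `x` behind.
x≢y∈p⇒2≤∣p∣ : ∀ {n} {p : Subset n} {x y} → x ∈ p → y ∈ p → x ≢ y → 2 ≤ ∣ p ∣
x≢y∈p⇒2≤∣p∣ x∈p y∈p x≢y =
  ≤-trans (s≤s (x∈p⇒1≤∣p∣ (x∈p∧x≢y⇒x∈p-y x∈p x≢y))) (x∈p⇒∣p-x∣<∣p∣ y∈p)

-- Neighbours labelled 2 in an arbitrary graph.

module _ {n} {G : Graph n} {f : Labelling n} where
  open Graph G

  ∈N∩V₂⁺ : ∀ {v w} → Adj v w → f w ≡ 2F → w ∈ N v ∩ V₂ f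
  ∈N∩V₂⁺ {v} v~w fw≡2 = x∈p∩q⁺ (∈-tabulate⁺ (adj? v) v~w , ∈-tabulate⁺ (λ w → f w ≟ 2F) fw≡2)

  ∈N∩V₂⁻ : ∀ {v w} → w ∈ N v ∩ V₂ f → Adj v w × f w ≡ 2F
  ∈N∩V₂⁻ {v} w∈ with w∈N , w∈V₂ ← x∈p∩q⁻ (N v) (V₂ f) w∈ =
    ∈-tabulate⁻ (adj? v) w∈N , ∈-tabulate⁻ (λ w → f w ≟ 2F) w∈V₂

  module _ (dom : IsRoman2TupleDominating G f) where
    open IsRoman2TupleDominating dom

    two-2-neighbours : ∀ {v} → f v ≡ 0F →
      ∃[ x ] ∃[ y ] (Adj v x × f x ≡ 2F) × (Adj v y × f y ≡ 2F) × x ≢ y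
    two-2-neighbours {v} fv≡0
      with x , y , x∈ , y∈ , x≢y ← 2≤∣p∣⇒∃≢ (N v ∩ V₂ f) (label≡0 v fv≡0) =
      x , y , ∈N∩V₂⁻ x∈ , ∈N∩V₂⁻ y∈ , x≢y

    2-neighbour : ∀ v → ∃[ w ] Adj v w × f w ≡ 2F
    2-neighbour v with f v ≟ 0F
    ... | yes fv≡0 with x , _ , x-ok , _ ← two-2-neighbours fv≡0 = x , x-ok
    ... | no  fv≢0 with w , w∈ ← 1≤∣p∣⇒Nonempty (N v ∩ V₂ f) (label≢0 v fv≢0) = w , ∈N∩V₂⁻ w∈

-- The cyclic successor relation.

Next-functional : ∀ {n} {v w w′ : Fin n} → Next v w → Next v w′ → w ≡ w′
Next-functional (inj₁ p) (inj₁ q) = toℕ-injective (trans p (sym q))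
-- Here `w` would have index `n`, which lies outside `Fin n`.
Next-functional {w = w} (inj₁ p) (inj₂ (q , _)) = contradiction (trans p q) (<⇒≢ (toℕ<n w))
Next-functional {w′ = w′} (inj₂ (p , _)) (inj₁ q) = contradiction (trans q p) (<⇒≢ (toℕ<n w′))
Next-functional (inj₂ (_ , p)) (inj₂ (_ , q)) = toℕ-injective (trans p (sym q))

Next-injective : ∀ {n} {u u′ v : Fin n} → Next u v → Next u′ v → u ≡ u′
Next-injective (inj₁ p) (inj₁ q) = toℕ-injective (suc-injective (trans (sym p) q))
Next-injective (inj₁ p) (inj₂ (_ , q)) = contradiction (trans (sym p) q) 1+n≢0
Next-injective (inj₂ (_ , p)) (inj₁ q) = contradiction (trans (sym q) p) 1+n≢0
Next-injective (inj₂ (p , _)) (inj₂ (q , _)) = toℕ-injective (suc-injective (trans p (sym q)))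

-- Going round in two steps would force n ≤ 2. This keeps the predecessor and the successor of a
-- vertex distinct, so that they count as two neighbours.
Next²-irrefl : ∀ {n} → 3 ≤ n → {u v : Fin n} → Next u v → ¬ Next v u
Next²-irrefl 3≤n {u} (inj₁ p) (inj₁ q) =
  contradiction (trans q (cong suc p)) (<⇒≢ (s≤s (m≤n+m (toℕ u) 1)))
Next²-irrefl 3≤n (inj₁ p) (inj₂ (q , r)) = <⇒≢ 3≤n (trans (cong (2 +_) (sym r)) (trans (cong suc (sym p)) q))
Next²-irrefl 3≤n (inj₂ (p , r)) (inj₁ q) = <⇒≢ 3≤n (trans (cong (2 +_) (sym r)) (trans (cong suc (sym q)) p))
Next²-irrefl 3≤n (inj₂ (p , _)) (inj₂ (_ , q)) =
  <⇒≢ (≤-trans (s≤s (s≤s z≤n)) 3≤n) (trans (cong suc (sym q)) p)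

-- The cycle unrolled: a natural number `i` stands for the vertex `i mod n`.

module _ {n} .{{_ : NonZero n}} where

  toℕ-mod : ∀ i → toℕ (i mod n) ≡ i % n
  toℕ-mod i = toℕ-fromℕ< (m%n<n i n)

  mod-toℕ : ∀ (v : Fin n) → toℕ v mod n ≡ v
  mod-toℕ v = toℕ-injective (trans (toℕ-mod (toℕ v)) (m<n⇒m%n≡m (toℕ<n v)))

  mod-periodic : ∀ i → (i + n) mod n ≡ i mod n
  mod-periodic i = toℕ-injective
    (trans (toℕ-mod (i + n)) (trans ([m+n]%n≡m%n i n) (sym (toℕ-mod i))))

  suc-% : ∀ i → suc i % n ≡ suc (i % n) % n
  suc-% i = trans (cong (λ m → suc m % n) (m≡m%n+[m/n]*n i n))
                  ([m+kn]%n≡m%n (suc (i % n)) (i / n) n)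

  Next-mod : ∀ i → Next (i mod n) (suc i mod n)
  Next-mod i rewrite toℕ-mod i | toℕ-mod (suc i) | suc-% i with m≤n⇒m<n∨m≡n (m%n<n i n)
  ... | inj₁ 1+i%n<n = inj₁ (m<n⇒m%n≡m 1+i%n<n)
  ... | inj₂ 1+i%n≡n = inj₂ (1+i%n≡n , trans (cong (_% n) 1+i%n≡n) (n%n≡0 n))

  successor : ∀ (v : Fin n) → ∃[ w ] Next v w
  successor v = suc (toℕ v) mod n ,
    subst (λ x → Next x (suc (toℕ v) mod n)) (mod-toℕ v) (Next-mod (toℕ v))

  predecessor : ∀ (v : Fin n) → ∃[ u ] Next u v
  predecessor v = i mod n , subst (Next (i mod n)) 1+i-mod (Next-mod i)
    where
    -- Adding n - 1 steps back by one modulo n, and also works at vertex 0, where a truncated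
    -- subtraction would not.
    i = toℕ v + pred n
    1+i-mod : suc i mod n ≡ v
    1+i-mod = begin
      suc i mod n              ≡⟨ cong (_mod n) (+-suc (toℕ v) (pred n)) ⟨
      (toℕ v + suc (pred n)) mod n ≡⟨ cong (λ m → (toℕ v + m) mod n) (suc-pred n) ⟩
      (toℕ v + n) mod n        ≡⟨ mod-periodic (toℕ v) ⟩
      toℕ v mod n              ≡⟨ mod-toℕ v ⟩
      v                        ∎
      where open ≡-Reasoning

-- Each neighbour lies in one of two directions, and each direction holds only one vertex. As `y`
-- and `z` differ they occupy both directions, so `x` meets one of them.
C-degree≤2 : ∀ {n} (3≤n : 3 ≤ n) → let open Graph (C n 3≤n) in
  ∀ {v x y z} → Adj v x → Adj v y → Adj v z → y ≢ z → x ≡ y ⊎ x ≡ z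
C-degree≤2 _ (inj₁ p) (inj₁ q) _        _   = inj₁ (Next-functional p q)
C-degree≤2 _ (inj₂ p) (inj₂ q) _        _   = inj₁ (Next-injective p q)
C-degree≤2 _ (inj₁ p) (inj₂ q) (inj₁ r) _   = inj₂ (Next-functional p r)
C-degree≤2 _ (inj₂ p) (inj₁ q) (inj₂ r) _   = inj₂ (Next-injective p r)
C-degree≤2 _ (inj₁ p) (inj₂ q) (inj₂ r) y≢z = contradiction (Next-injective q r) y≢z
C-degree≤2 _ (inj₂ p) (inj₁ q) (inj₁ r) y≢z = contradiction (Next-functional q r) y≢z

-- Local consequences of domination on the cycle.

4≤-triple : (a b c : Fin 3) → a ≡ 2F ⊎ c ≡ 2F → (b ≡ 0F → a ≡ 2F × c ≡ 2F) →
  (a ≡ 0F → b ≡ 2F) → (c ≡ 0F → b ≡ 2F) → 4 ≤ toℕ a + (toℕ b + toℕ c)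
4≤-triple a 2F c (inj₁ refl) _ _ _ = m≤m+n 4 (toℕ c)
4≤-triple a 2F c (inj₂ refl) _ _ _ = m≤n+m 4 (toℕ a)
4≤-triple a 0F c _ b≡0⇒ _ _ with refl , refl ← b≡0⇒ refl = ≤-refl
-- Under a middle label 1 the last two hypotheses exclude an outer 0; then a 2 on one side and at
-- least 1 on the other give 4.
4≤-triple a 1F 0F _ _ _ c≡0⇒ with () ← c≡0⇒ refl
4≤-triple 0F 1F c _ _ a≡0⇒ _ with () ← a≡0⇒ refl
4≤-triple 1F 1F 1F (inj₁ ())
4≤-triple 1F 1F 1F (inj₂ ())
4≤-triple 1F 1F 2F _ _ _ _ = ≤-refl
4≤-triple 2F 1F 1F _ _ _ _ = ≤-refl
4≤-triple 2F 1F 2F _ _ _ _ = m≤m+n 4 1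

module _ {n} (3≤n : 3 ≤ n) {f : Labelling n} (dom : IsRoman2TupleDominating (C n 3≤n) f) where
  open Graph (C n 3≤n)

  -- Domination provides two distinct neighbours labelled 2, and on a cycle these are all the
  -- neighbours there are.
  neighbours-of-0 : ∀ {v x} → f v ≡ 0F → Adj v x → f x ≡ 2F
  neighbours-of-0 fv≡0 v~x
    with y , z , (v~y , fy≡2) , (v~z , fz≡2) , y≢z ← two-2-neighbours dom fv≡0
    with C-degree≤2 3≤n v~x v~y v~z y≢z
  ... | inj₁ refl = fy≡2
  ... | inj₂ refl = fz≡2

  4≤-consecutive : ∀ {u v w} → Next u v → Next v w → 4 ≤ toℕ (f u) + (toℕ (f v) + toℕ (f w))
  4≤-consecutive {u} {v} {w} u→v v→w = 4≤-triple (f u) (f v) (f w)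
    2-beside-v
    (λ fv≡0 → neighbours-of-0 fv≡0 (inj₂ u→v) , neighbours-of-0 fv≡0 (inj₁ v→w))
    (λ fu≡0 → neighbours-of-0 fu≡0 (inj₁ u→v))
    (λ fw≡0 → neighbours-of-0 fw≡0 (inj₂ v→w))
    where
    2-beside-v : f u ≡ 2F ⊎ f w ≡ 2F
    2-beside-v with 2-neighbour dom v
    ... | x , inj₁ v→x , fx≡2 = inj₂ (trans (cong f (Next-functional v→w v→x)) fx≡2)
    ... | x , inj₂ x→v , fx≡2 = inj₁ (trans (cong f (Next-injective u→v x→v)) fx≡2)

  consecutive-2s : Fin n → ∃[ v ] ∃[ w ] Next v w × f v ≡ 2F × f w ≡ 2F
  consecutive-2s v₀ with v , _ , fv≡2 ← 2-neighbour dom v₀ with 2-neighbour dom v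
  ... | w , inj₁ v→w , fw≡2 = v , w , v→w , fv≡2 , fw≡2
  ... | w , inj₂ w→v , fw≡2 = w , v , w→v , fw≡2 , fv≡2

-- Sums over initial segments and over a period of a sequence.

initialSum : (ℕ → ℕ) → ℕ → ℕ
initialSum g n = ∑[ i < n ] g (toℕ i)

initialSum-suc : ∀ g n → initialSum g (suc n) ≡ initialSum g n + g n
initialSum-suc g zero    = +-comm (g 0) 0
initialSum-suc g (suc n) = begin
  g 0 + initialSum (g ∘ suc) (suc n)           ≡⟨ cong (g 0 +_) (initialSum-suc (g ∘ suc) n) ⟩
  g 0 + (initialSum (g ∘ suc) n + g (suc n))   ≡⟨ +-assoc (g 0) _ _ ⟨
  initialSum g (suc n) + g (suc n)             ∎
  where open ≡-Reasoning

-- Both sides arise from `initialSum g (suc n)`, by splitting off the first term or the last one;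
-- these two terms agree.
initialSum-rotate : ∀ g n → g n ≡ g 0 → initialSum (g ∘ suc) n ≡ initialSum g n
initialSum-rotate g n gn≡g0 = +-cancelˡ-≡ (g 0) _ _ (begin
  initialSum g (suc n)     ≡⟨ initialSum-suc g n ⟩
  initialSum g n + g n     ≡⟨ cong (λ x → initialSum g n + x) gn≡g0 ⟩
  initialSum g n + g 0     ≡⟨ +-comm _ (g 0) ⟩
  g 0 + initialSum g n     ∎)
  where open ≡-Reasoning

initialSum-triple : ∀ g m → initialSum g (3 + m) ≡ g 0 + (g 1 + g 2) + initialSum (g ∘ (3 +_)) m
initialSum-triple g m = sym (trans (+-assoc (g 0) (g 1 + g 2) _) (cong (g 0 +_) (+-assoc (g 1) (g 2) _)))

initialSum-≥ : ∀ k g → (∀ i → 4 ≤ g i + (g (1 + i) + g (2 + i))) → k * 4 ≤ initialSum g (k * 3)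
initialSum-≥ zero    g 4≤ = z≤n
initialSum-≥ (suc k) g 4≤ = begin
  4 + k * 4                                               ≤⟨ +-mono-≤ (4≤ 0)
                                                               (initialSum-≥ k (g ∘ (3 +_)) (4≤ ∘ (3 +_))) ⟩
  g 0 + (g 1 + g 2) + initialSum (g ∘ (3 +_)) (k * 3)     ≡⟨ initialSum-triple g (k * 3) ⟨
  initialSum g (3 + k * 3)                                ∎
  where open ≤-Reasoning

initialSum-≡ : ∀ k g → (∀ i → g i + (g (1 + i) + g (2 + i)) ≡ 4) → initialSum g (k * 3) ≡ k * 4
initialSum-≡ zero    g ≡4 = refl
initialSum-≡ (suc k) g ≡4 =
  trans (initialSum-triple g (k * 3)) (cong₂ _+_ (≡4 0) (initialSum-≡ k (g ∘ (3 +_)) (≡4 ∘ (3 +_))))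

initialSum-r : ∀ (r : Fin 3) m g → g 0 ≡ 2 → g 1 ≡ 2 →
  initialSum g (toℕ r + m) ≡ toℕ r * 2 + initialSum (g ∘ (toℕ r +_)) m
initialSum-r 0F m g _    _    = refl
initialSum-r 1F m g g0≡2 _    rewrite g0≡2 = refl
initialSum-r 2F m g g0≡2 g1≡2 rewrite g0≡2 | g1≡2 = refl

-- Induction on `a`: shifting the sequence by one keeps the sum over a period and moves the pair of
-- 2s one place closer to the front. Once it stands at positions 0 and 1, the first r terms are 2s
-- and the rest splits into triples.
periodic-sum-≥ : ∀ (r : Fin 3) k g → (∀ i → g (i + (toℕ r + k * 3)) ≡ g i) →
  (∀ i → 4 ≤ g i + (g (1 + i) + g (2 + i))) → ∀ a → g a ≡ 2 → g (suc a) ≡ 2 →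
  toℕ r * 2 + k * 4 ≤ initialSum g (toℕ r + k * 3)
periodic-sum-≥ r k g per 4≤ (suc a) ga ga′ =
  ≤-trans (periodic-sum-≥ r k (g ∘ suc) (per ∘ suc) (4≤ ∘ suc) a ga ga′)
          (≤-reflexive (initialSum-rotate g _ (per 0)))
periodic-sum-≥ r k g per 4≤ zero g0≡2 g1≡2 = begin
  toℕ r * 2 + k * 4                                    ≤⟨ +-monoʳ-≤ (toℕ r * 2)
                                                            (initialSum-≥ k (g ∘ (toℕ r +_)) (4≤-shifted r)) ⟩
  toℕ r * 2 + initialSum (g ∘ (toℕ r +_)) (k * 3)      ≡⟨ initialSum-r r (k * 3) g g0≡2 g1≡2 ⟨
  initialSum g (toℕ r + k * 3)                         ∎
  where
  open ≤-Reasoning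
  -- Only for a concrete `r` do the three indices compute to consecutive ones, hence the case split.
  4≤-shifted : ∀ (r : Fin 3) i → 4 ≤ g (toℕ r + i) + (g (toℕ r + (1 + i)) + g (toℕ r + (2 + i)))
  4≤-shifted 0F i = 4≤ i
  4≤-shifted 1F i = 4≤ (1 + i)
  4≤-shifted 2F i = 4≤ (2 + i)

-- The labelling is read as an n-periodic sequence on the natural numbers, whose sum over the first
-- n indices is the weight; the cut is made at `toℕ v`.
weight-≥ : ∀ (r : Fin 3) k 3≤n f → IsRoman2TupleDominating (C (toℕ r + k * 3) 3≤n) f →
  toℕ r * 2 + k * 4 ≤ weight f
weight-≥ r k 3≤n f dom = let v , w , v→w , fv≡2 , fw≡2 = consecutive-2s 3≤n dom (0 mod n) in
  subst (toℕ r * 2 + k * 4 ≤_) (sum-cong-≗ (cong (toℕ ∘ f) ∘ mod-toℕ))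
    (periodic-sum-≥ r k (λ i → toℕ (f (i mod n))) (cong (toℕ ∘ f) ∘ mod-periodic)
      (λ i → 4≤-consecutive 3≤n dom (Next-mod i) (Next-mod (suc i)))
      (toℕ v)
      (cong toℕ (trans (cong f (mod-toℕ v)) fv≡2))
      -- `suc (toℕ v) mod n` and `w` both follow `v`, hence coincide, even when `w` is reached by
      -- wrapping round.
      (cong toℕ (trans (cong f (Next-functional (proj₂ (successor v)) v→w)) fw≡2)))
  where
  n = toℕ r + k * 3
  instance _ = >-nonZero (≤-trans (s≤s z≤n) 3≤n)

-- The extremal labelling.

220-pattern : ℕ → Fin 3
220-pattern 0 = 2F
220-pattern 1 = 2F
220-pattern 2 = 0F
220-pattern (suc (suc (suc i))) = 220-pattern i

after-0 : ∀ i → 220-pattern i ≡ 0F → 220-pattern (1 + i) ≡ 2F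
after-0 2 _ = refl
after-0 (suc (suc (suc i))) = after-0 i

before-0 : ∀ i → 220-pattern (1 + i) ≡ 0F → 220-pattern i ≡ 2F
before-0 1 _ = refl
before-0 (suc (suc (suc i))) = before-0 i

2-beside : ∀ i → 220-pattern i ≡ 2F ⊎ 220-pattern (2 + i) ≡ 2F
2-beside 0 = inj₁ refl
2-beside 1 = inj₁ refl
2-beside 2 = inj₂ refl
2-beside (suc (suc (suc i))) = 2-beside i

220-pattern-triple : ∀ i →
  toℕ (220-pattern i) + (toℕ (220-pattern (1 + i)) + toℕ (220-pattern (2 + i))) ≡ 4
220-pattern-triple 0 = refl
220-pattern-triple 1 = refl
220-pattern-triple 2 = refl
220-pattern-triple (suc (suc (suc i))) = 220-pattern-triple i

220-labelling : ∀ n → Labelling n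
220-labelling n v = 220-pattern (toℕ v)

-- The first r labels are 2s, and any three consecutive labels of the pattern sum to exactly 4,
-- wherever the triples start.
220-weight : ∀ (r : Fin 3) k → weight (220-labelling (toℕ r + k * 3)) ≡ toℕ r * 2 + k * 4
220-weight r k = trans
  (initialSum-r r (k * 3) (toℕ ∘ 220-pattern) refl refl)
  (cong (toℕ r * 2 +_) (initialSum-≡ k (toℕ ∘ 220-pattern ∘ (toℕ r +_)) (shifted r)))
  where
  shifted : ∀ (r : Fin 3) i → toℕ (220-pattern (toℕ r + i)) +
    (toℕ (220-pattern (toℕ r + (1 + i))) + toℕ (220-pattern (toℕ r + (2 + i)))) ≡ 4
  shifted 0F i = 220-pattern-triple i
  shifted 1F i = 220-pattern-triple (1 + i)
  shifted 2F i = 220-pattern-triple (2 + i)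

module _ {n : ℕ} where
  private f = 220-labelling n

  -- The pattern may break off anywhere at vertex n - 1. Wrapping round does no harm, because vertex
  -- 0 is labelled 2 and so is vertex 1; the same observation settles the `inj₂` cases of the next
  -- two lemmas.
  220-after-0 : ∀ {v w} → Next v w → f v ≡ 0F → f w ≡ 2F
  220-after-0 {v} (inj₁ w≡1+v)   fv≡0 = trans (cong 220-pattern w≡1+v) (after-0 (toℕ v) fv≡0)
  220-after-0     (inj₂ (_ , w≡0)) _  = cong 220-pattern w≡0

  220-before-0 : ∀ {u v} → Next u v → f v ≡ 0F → f u ≡ 2F
  220-before-0 {u} (inj₁ v≡1+u) fv≡0 = before-0 (toℕ u) (trans (cong 220-pattern (sym v≡1+u)) fv≡0)
  220-before-0 (inj₂ (_ , v≡0)) fv≡0 with () ← trans (sym (cong 220-pattern v≡0)) fv≡0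

  220-beside : ∀ {u v w} → Next u v → Next v w → f u ≡ 2F ⊎ f w ≡ 2F
  220-beside _ (inj₂ (_ , w≡0)) = inj₂ (cong 220-pattern w≡0)
  220-beside {u} (inj₁ v≡1+u) (inj₁ w≡1+v) =
    Sum.map₂ (trans (cong 220-pattern (trans w≡1+v (cong suc v≡1+u)))) (2-beside (toℕ u))
  220-beside (inj₂ (_ , v≡0)) (inj₁ w≡1+v) =
    inj₂ (cong 220-pattern (trans w≡1+v (cong suc v≡0)))

220-dominating : ∀ {n} (3≤n : 3 ≤ n) → IsRoman2TupleDominating (C n 3≤n) (220-labelling n)
220-dominating {n} 3≤n = record { label≡0 = label≡0 ; label≢0 = λ v _ → label≢0 v }
  where
  instance _ = >-nonZero (≤-trans (s≤s z≤n) 3≤n)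
  open Graph (C n 3≤n)
  f = 220-labelling n
  ∈⁺ : ∀ {v w} → Adj v w → f w ≡ 2F → w ∈ N v ∩ V₂ f
  ∈⁺ = ∈N∩V₂⁺ {G = C n 3≤n} {f}

  label≡0 : ∀ v → f v ≡ 0F → 2 ≤ ∣ N v ∩ V₂ f ∣
  label≡0 v fv≡0 with u , u→v ← predecessor v | w , v→w ← successor v =
    x≢y∈p⇒2≤∣p∣ (∈⁺ (inj₂ u→v) (220-before-0 u→v fv≡0)) (∈⁺ (inj₁ v→w) (220-after-0 v→w fv≡0))
      λ { refl → Next²-irrefl 3≤n u→v v→w }

  label≢0 : ∀ v → 1 ≤ ∣ N v ∩ V₂ f ∣
  label≢0 v with u , u→v ← predecessor v | w , v→w ← successor v with 220-beside u→v v→w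
  ... | inj₁ fu≡2 = x∈p⇒1≤∣p∣ (∈⁺ (inj₂ u→v) fu≡2)
  ... | inj₂ fw≡2 = x∈p⇒1≤∣p∣ (∈⁺ (inj₁ v→w) fw≡2)

-- Evaluating the ceiling.

⌈/⌉-closed : ∀ m d → ⌈ m / suc d ⌉ ≡ m / suc d + 1 ⊓ (m % suc d)
⌈/⌉-closed zero d = refl
-- The ceiling is minus the floor of the negated fraction, and dividing a negative integer branches
-- on whether the remainder is zero, just as `1 ⊓ (m % suc d)` does.
⌈/⌉-closed (suc m) d rewrite ℤ.*-identityˡ (-[1+ m ] ℤ./ℕ suc d) with suc m % suc d
... | zero  = trans (cong ℤ.∣_∣ (ℤ.neg-involutive (ℤ.+ (suc m / suc d)))) (sym (+-identityʳ _))
... | suc _ = +-comm 1 (suc m / suc d)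

⌈[m+kd]/d⌉ : ∀ m k d → ⌈ m + k * suc d / suc d ⌉ ≡ ⌈ m / suc d ⌉ + k
⌈[m+kd]/d⌉ m k d = begin
  ⌈ m + k * D / D ⌉                                ≡⟨ ⌈/⌉-closed (m + k * D) d ⟩
  (m + k * D) / D + 1 ⊓ ((m + k * D) % D)            ≡⟨ cong₂ (λ q r → q + 1 ⊓ r) quot ([m+kn]%n≡m%n m k D) ⟩
  m / D + k + 1 ⊓ (m % D)                            ≡⟨ +-assoc (m / D) k _ ⟩
  m / D + (k + 1 ⊓ (m % D))                          ≡⟨ cong (m / D +_) (+-comm k _) ⟩
  m / D + (1 ⊓ (m % D) + k)                          ≡⟨ +-assoc (m / D) _ k ⟨
  m / D + 1 ⊓ (m % D) + k                            ≡⟨ cong (_+ k) (⌈/⌉-closed m d) ⟨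
  ⌈ m / D ⌉ + k                                    ∎
  where
  open ≡-Reasoning
  D = suc d
  quot : (m + k * D) / D ≡ m / D + k
  quot = trans (+-distrib-/-∣ʳ m (n∣m*n k)) (cong (m / D +_) (m*n/n≡m k D))

-- Since 2n = 2r + 2k * 3, the summand 2k leaves the ceiling, and ⌈2r/3⌉ = r for each r ≤ 2.
2⌈2n/3⌉ : ∀ (r : Fin 3) k → 2 * ⌈ 2 * (toℕ r + k * 3) / 3 ⌉ ≡ toℕ r * 2 + k * 4
2⌈2n/3⌉ r k = begin
  2 * ⌈ 2 * (toℕ r + k * 3) / 3 ⌉        ≡⟨ cong (λ m → 2 * ⌈ m / 3 ⌉) (*-distribˡ-+ 2 (toℕ r) (k * 3)) ⟩
  2 * ⌈ 2 * toℕ r + 2 * (k * 3) / 3 ⌉    ≡⟨ cong (λ m → 2 * ⌈ 2 * toℕ r + m / 3 ⌉) (sym (*-assoc 2 k 3)) ⟩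
  2 * ⌈ 2 * toℕ r + 2 * k * 3 / 3 ⌉      ≡⟨ cong (2 *_) (⌈[m+kd]/d⌉ (2 * toℕ r) (2 * k) 2) ⟩
  2 * (⌈ 2 * toℕ r / 3 ⌉ + 2 * k)        ≡⟨ cong (λ m → 2 * (m + 2 * k)) (⌈2r/3⌉ r) ⟩
  2 * (toℕ r + 2 * k)                    ≡⟨ solve 2 (λ r k → con 2 :* (r :+ con 2 :* k) := r :* con 2 :+ k :* con 4)
                                                   refl (toℕ r) k ⟩
  toℕ r * 2 + k * 4                      ∎
  where
  open ≡-Reasoning
  open +-*-Solver using (solve; con; _:*_; _:+_; _:=_)
  ⌈2r/3⌉ : ∀ (r : Fin 3) → ⌈ 2 * toℕ r / 3 ⌉ ≡ toℕ r
  ⌈2r/3⌉ 0F = refl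
  ⌈2r/3⌉ 1F = refl
  ⌈2r/3⌉ 2F = refl

proposition6 : (n : ℕ) (3≤n : 3 ≤ n) → γ×2R[ C n 3≤n ]≡ (2 * ⌈ 2 * n / 3 ⌉)
-- Division by 3 writes n as r + 3k and turns the claimed value into 2r + 4k, the form in which both
-- bounds are stated.
proposition6 n 3≤n with result k r refl ← n divMod 3 rewrite 2⌈2n/3⌉ r k =
  (220-labelling n , 220-dominating 3≤n , 220-weight r k) , weight-≥ r k 3≤n
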